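{- Let $P$ be a countable meet-continuous dcpo such that, for every $r\in P$, every nonempty subset of the principal ideal $\mathord{\downarrow}r$ has a supremum in $\mathord{\downarrow}r$. (In particular, $P$ may be a countable meet-continuous $L$-dcpo.) If any one of the following conditions holds, then the Scott space $\Sigma P$ is sober: (1) $\Sigma P$ is a strong $d$-space; (2) $\Sigma P$ has property $R$; (3) $\Sigma P$ is well-filtered and coherent; (4) $(P,\lambda(P))$ is upper-semicompact.
   Context: All posets and directed sets are nonempty; countable sets may be finite. A subset $D$ of a poset is directed if any two of its elements have a common upper bound in $D$. A dcpo is a poset in which every directed subset has a supremum. Write $\mathord{\downarrow}x=\{y:y\le x\}$, $\mathord{\uparrow}x=\{y:x\le y\}$, $\mathord{\downarrow}A=\bigcup_{a\in A}\mathord{\downarrow}a$ and $\mathord{\uparrow}A=\bigcup_{a\in A}\mathord{\uparrow}a$. A supremum in $\mathord{\downarrow}r$ means a least upper bound computed in $\mathord{\downarrow}r$ with its induced order. For a dcpo $P$, an upper set $U\subseteq P$ is Scott open if for every directed $D\subseteq P$, $\bigvee D\in U$ implies $D\cap U\neq\emptyset$; the Scott open sets form the Scott topology $\sigma(P)$, and $\Sigma P=(P,\sigma(P))$ is the Scott space (its specialization order is the order of $P$). A dcpo $P$ is meet-continuous if for every $x\in P$ and every directed $D\subseteq P$, $x\le\bigvee D$ implies $x\in\operatorname{cl}_{\sigma(P)}(\mathord{\downarrow}x\cap\mathord{\downarrow}D)$. A dcpo $P$ is an $L$-dcpo if every principal ideal $\mathord{\downarrow}r$ is a complete lattice in its induced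 order. A nonempty Scott-closed set $A$ is irreducible if any two open sets meeting $A$ have an intersection meeting $A$. $\Sigma P$ is sober if each irreducible closed set $A$ equals $\mathord{\downarrow}a$ for a unique $a\in P$. For a $T_0$ space $X$, the symbol $\mathord{\uparrow}$ refers to the specialization order. $X$ is a strong $d$-space if for every nonempty set $D$ directed in the specialization order, every $x\in X$ and every open $U\subseteq X$, $\bigcap_{d\in D}(\mathord{\uparrow}d\cap\mathord{\uparrow}x)\subseteq U$ implies $\mathord{\uparrow}d\cap\mathord{\uparrow}x\subseteq U$ for some $d\in D$. $X$ has property $R$ if for every family $(F_i)_{i\in I}$ of finite subsets of $X$ and every open $U$, $\bigcap_{i\in I}\mathord{\uparrow}F_i\subseteq U$ implies $\bigcap_{i\in I_0}\mathord{\uparrow}F_i\subseteq U$ for some finite $I_0\subseteq I$. $X$ is well-filtered if for every filtered (down-directed under inclusion) family $\mathcal K$ of compact saturated sets and every open $U$, $\bigcap\mathcal K\subseteq U$ implies $K\subseteq U$ for some $K\in\mathcal K$; $X$ is coherent if the intersection of any two compact saturated sets is compact. $\lambda(P)$ is the Lawson topology: the join of the Scott topology and the lower topology generated by the sets $P\setminus\mathord{\uparrow}x$, $x\in P$. $(P,\lambda(P))$ is upper-semicompact if every principal upper set $\mathord{\uparrow}x$ is compact in $\lambda(P)$. -}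

module Defs where

open import Level using (Level; Lift; suc; _⊔_)
open import Data.List.Base using (List)
open import Data.List.Relation.Unary.All using (All)
open import Data.List.Relation.Unary.Any using (Any)
open import Data.Nat.Base using (ℕ)
open import Data.Product using (∃; ∃-syntax; ∃!; _×_; _,_; proj₁; proj₂)
open import Function.Bundles using (Injection)
open import Relation.Binary.Bundles using (Poset; Setoid)
open import Relation.Binary.Core using (Rel)
import Relation.Binary.PropositionalEquality as ≡
open import Relation.Unary
  using (Pred; _∈_; _⊆_; _≐_; _∩_; _∪_; ∁; ⋃; _≬_; Satisfiable)
open import Relation.Unary.Polymorphic using (U)

private
  variable
    a r : Level

IsDirected : {X : Set a} → Rel X r → Pred X a → Set (a ⊔ r)
IsDirected _∼_ D =
  Satisfiable D ×
  (∀ {x y} → x ∈ D → y ∈ D → ∃[ z ] (z ∈ D × x ∼ z × y ∼ z))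

-- Subsets of X : Set ℓ are predicates valued in Set ℓ, and families of subsets
-- are indexed by types in Set ℓ.  Under excluded middle every subset of X is
-- given by a function X → Bool, so these universe bounds lose no subset and no
-- collection of subsets.

record Topology {ℓ} (X : Set ℓ) : Set (suc (suc ℓ)) where
  field
    IsOpen : Pred (Pred X ℓ) (suc ℓ)
    open-≐ : ∀ {V W} → V ≐ W → IsOpen V → IsOpen W
    open-U : IsOpen U
    open-∩ : ∀ {V W} → IsOpen V → IsOpen W → IsOpen (V ∩ W)
    open-⋃ : ∀ {I : Set ℓ} (V : I → Pred X ℓ) →
             (∀ i → IsOpen (V i)) → IsOpen (⋃ I V)

data Generated {ℓ} {X : Set ℓ} (B : Pred (Pred X ℓ) (suc ℓ)) :
               Pred (Pred X ℓ) (suc ℓ) where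
  basic : ∀ {V} → V ∈ B → Generated B V
  gen-≐ : ∀ {V W} → V ≐ W → Generated B V → Generated B W
  gen-U : Generated B U
  gen-∩ : ∀ {V W} → Generated B V → Generated B W → Generated B (V ∩ W)
  gen-⋃ : ∀ {I : Set ℓ} (V : I → Pred X ℓ) →
          (∀ i → Generated B (V i)) → Generated B (⋃ I V)

generatedBy : ∀ {ℓ} {X : Set ℓ} → Pred (Pred X ℓ) (suc ℓ) → Topology X
generatedBy B = record
  { IsOpen = Generated B
  ; open-≐ = gen-≐
  ; open-U = gen-U
  ; open-∩ = gen-∩
  ; open-⋃ = gen-⋃
  }

_∨ᵗ_ : ∀ {ℓ} {X : Set ℓ} → Topology X → Topology X → Topology X
S ∨ᵗ T = generatedBy (Topology.IsOpen S ∪ Topology.IsOpen T)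

module Topological {ℓ} {X : Set ℓ} (T : Topology X) where
  open Topology T

  IsClosed : Pred (Pred X ℓ) (suc ℓ)
  IsClosed A = IsOpen (∁ A)

  cl : Pred X ℓ → Pred X (suc ℓ)
  cl A x = ∀ C → IsClosed C → A ⊆ C → x ∈ C

  IsIrreducible : Pred (Pred X ℓ) (suc ℓ)
  IsIrreducible A =
    Satisfiable A ×
    (∀ V W → IsOpen V → IsOpen W → A ≬ V → A ≬ W → A ≬ (V ∩ W))

  -- Specialization order: x lies in the closure of y.
  infix 4 _⊑_
  _⊑_ : Rel X (suc ℓ)
  x ⊑ y = ∀ V → IsOpen V → x ∈ V → y ∈ V

  ↑ˢ : X → Pred X (suc ℓ)
  ↑ˢ x y = x ⊑ y

  IsCompact : Pred (Pred X ℓ) (suc ℓ)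
  IsCompact K =
    ∀ {I : Set ℓ} (V : I → Pred X ℓ) → (∀ i → IsOpen (V i)) → K ⊆ ⋃ I V →
    ∃[ is ] (K ⊆ λ x → Any (λ i → x ∈ V i) is)

  IsSaturated : Pred (Pred X ℓ) (suc ℓ)
  IsSaturated K = ∀ {x y} → x ⊑ y → x ∈ K → y ∈ K

  IsCompactSaturated : Pred (Pred X ℓ) (suc ℓ)
  IsCompactSaturated K = IsCompact K × IsSaturated K

  IsStrongDSpace : Set (suc ℓ)
  IsStrongDSpace =
    ∀ (D : Pred X ℓ) → IsDirected _⊑_ D → ∀ x V → IsOpen V →
    (λ y → ∀ d → d ∈ D → y ∈ ↑ˢ d ∩ ↑ˢ x) ⊆ V →
    ∃[ d ] (d ∈ D × ↑ˢ d ∩ ↑ˢ x ⊆ V)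

  -- A finite subset of X, or of an index type, is given by a list enumerating it.
  ↑ᶠ : List X → Pred X (suc ℓ)
  ↑ᶠ F y = Any (λ x → y ∈ ↑ˢ x) F

  HasPropertyR : Set (suc ℓ)
  HasPropertyR =
    ∀ {I : Set ℓ} (F : I → List X) V → IsOpen V →
    (λ x → ∀ i → x ∈ ↑ᶠ (F i)) ⊆ V →
    ∃[ is ] ((λ x → All (λ i → x ∈ ↑ᶠ (F i)) is) ⊆ V)

  IsWellFiltered : Set (suc ℓ)
  IsWellFiltered =
    ∀ {I : Set ℓ} (K : I → Pred X ℓ) → (∀ i → IsCompactSaturated (K i)) →
    I → (∀ i j → ∃[ k ] (K k ⊆ K i × K k ⊆ K j)) →
    ∀ V → IsOpen V → (λ x → ∀ i → x ∈ K i) ⊆ V → ∃[ i ] (K i ⊆ V)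

  IsCoherent : Set (suc ℓ)
  IsCoherent =
    ∀ K L → IsCompactSaturated K → IsCompactSaturated L → IsCompact (K ∩ L)

IsCountable : ∀ {a ℓ} → Setoid a ℓ → Set (a ⊔ ℓ)
IsCountable S = Injection S (≡.setoid ℕ)

module PosetTheory {ℓ} (P : Poset ℓ ℓ ℓ) where
  open Poset P

  ↓ : Carrier → Pred Carrier ℓ
  ↓ x y = y ≤ x

  ↑ : Carrier → Pred Carrier ℓ
  ↑ x y = x ≤ y

  ↓ˢᵉᵗ : Pred Carrier ℓ → Pred Carrier ℓ
  ↓ˢᵉᵗ A y = ∃[ x ] (x ∈ A × y ∈ ↓ x)

  record IsLub (S : Pred Carrier ℓ) (s : Carrier) : Set ℓ where
    field
      upper : ∀ {x} → x ∈ S → x ≤ s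
      least : ∀ {u} → (∀ {x} → x ∈ S → x ≤ u) → s ≤ u

  -- Bounds of S within the subposet B, in its induced order.
  record IsLubIn (B S : Pred Carrier ℓ) (s : Carrier) : Set ℓ where
    field
      inside : s ∈ B
      upper  : ∀ {x} → x ∈ S → x ≤ s
      least  : ∀ {u} → u ∈ B → (∀ {x} → x ∈ S → x ≤ u) → s ≤ u

  record IsGlbIn (B S : Pred Carrier ℓ) (s : Carrier) : Set ℓ where
    field
      inside   : s ∈ B
      lower    : ∀ {x} → x ∈ S → s ≤ x
      greatest : ∀ {l} → l ∈ B → (∀ {x} → x ∈ S → l ≤ x) → l ≤ s

  IsDCPO : Set (suc ℓ)
  IsDCPO = ∀ (D : Pred Carrier ℓ) → IsDirected _≤_ D → ∃ (IsLub D)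

  IsLDCPO : Set (suc ℓ)
  IsLDCPO =
    IsDCPO ×
    (∀ r (S : Pred Carrier ℓ) → S ⊆ ↓ r →
     ∃ (IsLubIn (↓ r) S) × ∃ (IsGlbIn (↓ r) S))

  IdealsHaveNonemptySups : Set (suc ℓ)
  IdealsHaveNonemptySups =
    ∀ r (S : Pred Carrier ℓ) → Satisfiable S → S ⊆ ↓ r → ∃ (IsLubIn (↓ r) S)

  IsLDCPO⇒IdealsHaveNonemptySups : IsLDCPO → IdealsHaveNonemptySups
  IsLDCPO⇒IdealsHaveNonemptySups (_ , complete) r S _ S⊆↓r =
    proj₁ (complete r S S⊆↓r)

  record IsScottOpen (V : Pred Carrier ℓ) : Set (suc ℓ) where
    field
      up           : ∀ {x y} → x ≤ y → x ∈ V → y ∈ V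
      inaccessible : ∀ {D s} → IsDirected _≤_ D → IsLub D s → s ∈ V → D ≬ V

  open IsScottOpen

  scott-≐ : ∀ {V W} → V ≐ W → IsScottOpen V → IsScottOpen W
  scott-≐ (V⊆W , W⊆V) o .up x≤y x∈W = V⊆W (o .up x≤y (W⊆V x∈W))
  scott-≐ (V⊆W , W⊆V) o .inaccessible dir lub s∈W =
    let d , d∈D , d∈V = o .inaccessible dir lub (W⊆V s∈W)
    in  d , d∈D , V⊆W d∈V

  scott-U : IsScottOpen U
  scott-U .up _ t = t
  scott-U .inaccessible ((d , d∈D) , _) _ t = d , d∈D , t

  scott-∩ : ∀ {V W} → IsScottOpen V → IsScottOpen W → IsScottOpen (V ∩ W)
  scott-∩ o o′ .up x≤y (x∈V , x∈W) = o .up x≤y x∈V , o′ .up x≤y x∈W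
  scott-∩ o o′ .inaccessible dir lub (s∈V , s∈W) =
    let d , d∈D , d∈V       = o .inaccessible dir lub s∈V
        e , e∈D , e∈W       = o′ .inaccessible dir lub s∈W
        z , z∈D , d≤z , e≤z = proj₂ dir d∈D e∈D
    in  z , z∈D , o .up d≤z d∈V , o′ .up e≤z e∈W

  scott-⋃ : ∀ {I : Set ℓ} (V : I → Pred Carrier ℓ) →
            (∀ i → IsScottOpen (V i)) → IsScottOpen (⋃ I V)
  scott-⋃ V o .up x≤y (i , x∈V) = i , o i .up x≤y x∈V
  scott-⋃ V o .inaccessible dir lub (i , s∈V) =
    let d , d∈D , d∈V = o i .inaccessible dir lub s∈V
    in  d , d∈D , i , d∈V

  scott : Topology Carrier
  scott = record
    { IsOpen = IsScottOpen
    ; open-≐ = scott-≐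
    ; open-U = scott-U
    ; open-∩ = scott-∩
    ; open-⋃ = scott-⋃
    }

  lower : Topology Carrier
  lower = generatedBy λ V → Lift (suc ℓ) (∃[ x ] V ≐ ∁ (↑ x))

  lawson : Topology Carrier
  lawson = scott ∨ᵗ lower

  open Topological scott public
    using (IsStrongDSpace; HasPropertyR; IsWellFiltered; IsCoherent)
    renaming (IsClosed to IsScottClosed; cl to clσ; IsIrreducible to IsIrreducibleσ)

  IsMeetContinuous : Set (suc ℓ)
  IsMeetContinuous =
    ∀ x (D : Pred Carrier ℓ) s → IsDirected _≤_ D → IsLub D s → x ≤ s →
    x ∈ clσ (↓ x ∩ ↓ˢᵉᵗ D)

  IsScottSober : Set (suc ℓ)
  IsScottSober =
    ∀ (A : Pred Carrier ℓ) → IsScottClosed A → IsIrreducibleσ A →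
    ∃! _≈_ (λ a → A ≐ ↓ a)

  IsUpperSemicompact : Set (suc ℓ)
  IsUpperSemicompact = ∀ x → Topological.IsCompact lawson (↑ x)

{-# OPTIONS --safe #-}
-- All four conditions make Σ P a strong d-space.  For a Scott closed A, this
-- says that the relation W x y, "no element of A lies above both x and y", has
-- Scott open sections.  The heart of the proof is that W a b then already gives
-- Scott open sets V ∋ a and V′ ∋ b with V × V′ ⊆ W; hence an irreducible closed
-- set is directed and has its supremum as greatest element.
--
-- V and V′ are generated by finite sets that grow in stages: the n-th stage
-- adds to either side a member of a set Q n, if W allows one.  Countably many
-- sets Q n suffice to make V inaccessible by directed suprema: a directed D that
-- escapes V would produce elements w n and d n of one principal ideal with
-- w n ≤ d l exactly when n ≢ l.  The suprema of the sets { w n ∣ n ∈ S } would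
-- then be distinct for distinct S ⊆ ℕ, against countability.
module Submission where

open import Axiom.ExcludedMiddle using (ExcludedMiddle)
open import Data.Empty using (⊥; ⊥-elim)
open import Data.List.Base using (List; []; _∷_)
open import Data.List.Membership.Propositional using (find) renaming (_∈_ to _∈ˡ_)
open import Data.List.Relation.Unary.All as All using (All; []; _∷_)
open import Data.List.Relation.Unary.Any as Any using (Any; here; there)
open import Data.Maybe.Base using (Maybe; just; nothing)
open import Data.Maybe.Relation.Unary.All as Maybe using (just; nothing)
open import Data.Nat.Base using (ℕ; zero; suc; _+_; _⊔_; _≤′_; ≤′-refl; ≤′-step)
open import Data.Nat.Properties
  using (+-identityʳ; +-suc; ≤⇒≤′; m≤m⊔n; m≤n⊔m; <-cmp)
open import Data.Product.Base
  using (Σ; ∃; ∃₂; ∃-syntax; _×_; _,_; proj₁; proj₂; map₂)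
open import Data.Sum.Base using (_⊎_; inj₁; inj₂; [_,_]′)
open import Function.Base using (_∘_; id; flip)
open import Function.Bundles using (Injection)
open import Level using (Level; Lift; lift) renaming (suc to lsuc)
open import Relation.Binary.Bundles using (Poset)
open import Relation.Binary.Core using (Rel)
open import Relation.Binary.Definitions using (tri<; tri≈; tri>)
open import Relation.Binary.PropositionalEquality
  using (_≡_; _≢_; refl; sym; subst)
open import Relation.Nullary using (¬_; yes; no)
open import Relation.Nullary.Decidable using (decidable-stable)
open import Relation.Unary
  using (Pred; _∈_; _⊆_; _≐_; _∩_; ∁; _≬_)
open import Defs

-- Cantor's enumeration of ℕ × ℕ along the antidiagonals.
unpair : ℕ → ℕ × ℕ
unpair zero = 0 , 0
unpair (suc n) = next (unpair n)
  where
  next : ℕ × ℕ → ℕ × ℕ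
  next (zero  , y) = suc y , 0
  next (suc x , y) = x , suc y

unpair-surjective : ∀ x y → ∃[ n ] unpair n ≡ (x , y)
unpair-surjective x y = antidiagonal x y (axis (x + y))
  where
  antidiagonal : ∀ x y → ∃[ n ] unpair n ≡ (x + y , 0) →
                 ∃[ n ] unpair n ≡ (x , y)
  antidiagonal x zero    (n , eq) rewrite +-identityʳ x = n , eq
  antidiagonal x (suc y) hit rewrite +-suc x y
    with n , eq ← antidiagonal (suc x) y hit = suc n , lemma
    where
    lemma : unpair (suc n) ≡ (x , suc y)
    lemma rewrite eq = refl

  axis : ∀ x → ∃[ n ] unpair n ≡ (x , 0)
  axis zero = 0 , refl
  axis (suc x) with n , eq ← antidiagonal 0 x (axis x) = suc n , lemma
    where
    lemma : unpair (suc n) ≡ (suc x , 0)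
    lemma rewrite eq = refl

module Classical
  (em : ∀ {a} → ExcludedMiddle a)
  {ℓ} (P : Poset ℓ ℓ ℓ)
  where

  open Poset P
    using (Carrier; _≈_; _≤_; antisym; reflexive; module Eq)
    renaming (refl to ≤-refl; trans to ≤-trans)
  open PosetTheory P
  open IsScottOpen
  open IsLub
  open Topological scott using (_⊑_)

  private
    variable
      q : Level

  stable : ∀ {a} {A : Set a} → ¬ ¬ A → A
  stable = decidable-stable em

  -- The Scott topology and its specialization order.

  ∁↓-open : ∀ y → IsScottOpen (∁ (↓ y))
  ∁↓-open y .up x≤z x≰y z≤y = x≰y (≤-trans x≤z z≤y)
  ∁↓-open y .inaccessible dir lub s≰y = stable λ none →
    s≰y (lub .least λ {d} d∈D → stable λ d≰y → none (d , d∈D , d≰y))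

  ∅-closed : IsScottClosed (λ _ → Lift ℓ ⊥)
  ∅-closed = scott-≐ ((λ _ ()) , _) scott-U

  ⊑⇒≤ : ∀ {x y} → x ⊑ y → x ≤ y
  ⊑⇒≤ {y = y} x⊑y = stable λ x≰y → x⊑y _ (∁↓-open y) x≰y ≤-refl

  ≤⇒⊑ : ∀ {x y} → x ≤ y → x ⊑ y
  ≤⇒⊑ x≤y V o = o .up x≤y

  ⊑-directed⇒directed : ∀ {D : Pred Carrier ℓ} → IsDirected _⊑_ D → IsDirected _≤_ D
  ⊑-directed⇒directed (ne , dir) = ne , λ x∈D y∈D →
    let z , z∈D , x⊑z , y⊑z = dir x∈D y∈D in z , z∈D , ⊑⇒≤ x⊑z , ⊑⇒≤ y⊑z

  directed⇒⊑-directed : ∀ {D : Pred Carrier ℓ} → IsDirected _≤_ D → IsDirected _⊑_ D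
  directed⇒⊑-directed (ne , dir) = ne , λ x∈D y∈D →
    let z , z∈D , x≤z , y≤z = dir x∈D y∈D in z , z∈D , ≤⇒⊑ x≤z , ≤⇒⊑ y≤z

  -- Four ways to a strong d-space.

  finite-bound : ∀ {D : Pred Carrier ℓ} → IsDirected _≤_ D →
                 (is : List (Maybe (∃ D))) →
                 ∃[ d ] (d ∈ D × All (Maybe.All λ e → proj₁ e ≤ d) is)
  finite-bound ((d , d∈D) , _) [] = d , d∈D , []
  finite-bound dir (nothing ∷ is) =
    let d , d∈D , bd = finite-bound dir is in d , d∈D , nothing ∷ bd
  finite-bound dir (just (e , e∈D) ∷ is) =
    let d , d∈D , bd        = finite-bound dir is
        z , z∈D , e≤z , d≤z = proj₂ dir e∈D d∈D
    in  z , z∈D , just e≤z ∷ All.map (Maybe.map λ p → ≤-trans p d≤z) bd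

  -- The singletons are those of the `d ∈ D`, and that of `x` at the index `nothing`. A finite
  -- subfamily mentions finitely many members of `D`, and one `d` bounds them all.
  propertyR⇒strongD : HasPropertyR → IsStrongDSpace
  propertyR⇒strongD hasR D dir x V V-open ⋂⊆V =
    let is , is⊆V = hasR F V V-open λ y∈ → ⋂⊆V λ where
                      d d∈D → from-singleton (y∈ (just (d , d∈D))) ,
                              from-singleton (y∈ nothing)
        d , d∈D , bd = finite-bound (⊑-directed⇒directed dir) is
    in  d , d∈D , λ (d⊑y , x⊑y) → is⊆V (All.map (λ where
          (just e≤d) → here λ W o → d⊑y W o ∘ ≤⇒⊑ e≤d W o
          nothing    → here x⊑y) bd)
    where
    F : Maybe (∃ D) → List Carrier
    F (just (d , _)) = d ∷ []
    F nothing        = x ∷ []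

    from-singleton : ∀ {y z} → Any (_⊑ y) (z ∷ []) → z ⊑ y
    from-singleton (here z⊑y) = z⊑y

  ↑-compactSaturated : ∀ x → Topological.IsCompactSaturated scott (↑ x)
  ↑-compactSaturated x = compact , λ y⊑z x≤y → ≤-trans x≤y (⊑⇒≤ y⊑z)
    where
    compact : Topological.IsCompact scott (↑ x)
    compact V V-open cover =
      let i , x∈Vi = cover ≤-refl
      in  i ∷ [] , λ x≤y → here (V-open i .up x≤y x∈Vi)

  -- Coherence makes every `↑ d ∩ ↑ x` compact; directedness of `D` makes these sets filtered.
  wellFiltered×coherent⇒strongD : IsWellFiltered × IsCoherent → IsStrongDSpace
  wellFiltered×coherent⇒strongD (wf , coh) D dir@((d₀ , d₀∈D) , _) x V V-open ⋂⊆V =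
    let (d , d∈D) , Kd⊆V = wf K K-compact (d₀ , d₀∈D) filtered V V-open λ y∈ →
          ⋂⊆V λ d d∈D → let d≤y , x≤y = y∈ (d , d∈D) in ≤⇒⊑ d≤y , ≤⇒⊑ x≤y
    in  d , d∈D , λ (d⊑y , x⊑y) → Kd⊆V (⊑⇒≤ d⊑y , ⊑⇒≤ x⊑y)
    where
    K : ∃ D → Pred Carrier ℓ
    K (d , _) = ↑ d ∩ ↑ x

    K-compact : ∀ i → Topological.IsCompactSaturated scott (K i)
    K-compact (d , _) =
      coh _ _ (↑-compactSaturated d) (↑-compactSaturated x) ,
      λ y⊑z (d≤y , x≤y) → ≤-trans d≤y (⊑⇒≤ y⊑z) , ≤-trans x≤y (⊑⇒≤ y⊑z)

    filtered : ∀ i j → ∃[ k ] (K k ⊆ K i × K k ⊆ K j)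
    filtered (d , d∈D) (e , e∈D) =
      let z , z∈D , d≤z , e≤z = proj₂ (⊑-directed⇒directed dir) d∈D e∈D
      in  (z , z∈D) , (λ (z≤y , x≤y) → ≤-trans d≤z z≤y , x≤y)
                    , (λ (z≤y , x≤y) → ≤-trans e≤z z≤y , x≤y)

  -- `V` and the complements of the sets `↑ d` form a Lawson open cover of `↑ x`. Above a bound of
  -- the finitely many members of `D` in a subcover, only `V` can do the covering.
  upperSemicompact⇒strongD : IsUpperSemicompact → IsStrongDSpace
  upperSemicompact⇒strongD usc D dir x V V-open ⋂⊆V =
    let is , is-cover = usc x cover cover-open covers
        d , d∈D , bd  = finite-bound (⊑-directed⇒directed dir) is
    in  d , d∈D , λ (d⊑y , x⊑y) →
          only-V bd (⊑⇒≤ d⊑y) (is-cover (⊑⇒≤ x⊑y))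
    where
    cover : Maybe (∃ D) → Pred Carrier ℓ
    cover (just (d , _)) = ∁ (↑ d)
    cover nothing        = V

    cover-open : ∀ i → Topology.IsOpen lawson (cover i)
    cover-open (just (d , _)) =
      basic (inj₂ (basic (lift (d , id , id))))
    cover-open nothing        = basic (inj₁ V-open)

    covers : ∀ {y} → x ≤ y → ∃[ i ] y ∈ cover i
    covers {y} x≤y with em {P = y ∈ V}
    ... | yes y∈V = nothing , y∈V
    ... | no  y∉V = stable λ none → y∉V (⋂⊆V λ d d∈D →
            ≤⇒⊑ (stable λ d≰y → none (just (d , d∈D) , d≰y)) , ≤⇒⊑ x≤y)

    only-V : ∀ {d y is} → All (Maybe.All λ e → proj₁ e ≤ d) is →
             d ≤ y → Any (λ i → y ∈ cover i) is → y ∈ V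
    only-V (nothing ∷ _)  d≤y (here y∈V) = y∈V
    only-V (just e≤d ∷ _) d≤y (here e≰y) = ⊥-elim (e≰y (≤-trans e≤d d≤y))
    only-V (_ ∷ bd)       d≤y (there p)  = only-V bd d≤y p

  -- Incompatibility in a closed set.

  Incompatible : Pred Carrier ℓ → Rel Carrier ℓ
  Incompatible A x y = ¬ (∃[ c ] (c ∈ A × x ≤ c × y ≤ c))

  -- A point of `A` above `x` and all of `D` would be above the supremum as well, so the strong
  -- d-property applies with the open set `∁ A`.
  incompatible-open : IsStrongDSpace → ∀ {A} → IsScottClosed A →
                      ∀ x → IsScottOpen (Incompatible A x)
  incompatible-open sd closed x .up y≤z x#y (c , c∈A , x≤c , z≤c) =
    x#y (c , c∈A , x≤c , ≤-trans y≤z z≤c)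
  incompatible-open sd {A} closed x .inaccessible {D} dir lub x#s =
    let d , d∈D , ⊆∁A = sd D (directed⇒⊑-directed dir) x (∁ A) closed
          λ {c} c∈ c∈A → x#s (c , c∈A , ⊑⇒≤ (proj₂ (c∈ _ (proj₂ (proj₁ dir)))) ,
            lub .least λ d∈D → ⊑⇒≤ (proj₁ (c∈ _ d∈D)))
    in  d , d∈D , λ (c , c∈A , x≤c , d≤c) → ⊆∁A (≤⇒⊑ d≤c , ≤⇒⊑ x≤c) c∈A

  UpClosed : Pred Carrier ℓ → Set ℓ
  UpClosed V = ∀ {x y} → x ≤ y → x ∈ V → y ∈ V

  -- The premise on `m` says that `m` is in the Scott closure of `Q`; `clσ` itself takes only
  -- predicates of level `ℓ`. Scott open sets have this property for every `Q`; later a countable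
  -- list of `Q` gives the converse for upper sets.
  Meets : Pred Carrier ℓ → Pred Carrier q → Set _
  Meets V Q = ∀ {m} → m ∈ V → (∀ O → IsScottOpen O → m ∈ O → O ≬ Q) → V ≬ Q

  -- Rectangles growing inside a symmetric relation.

  module Rectangles
    (W : Rel Carrier ℓ)
    (W-sym : ∀ {x y} → W x y → W y x)
    (W-open : ∀ x → IsScottOpen (W x))
    where

    record Rectangle : Set ℓ where
      field
        left right : List Carrier
        inside     : ∀ {x y} → x ∈ˡ left → y ∈ˡ right → W x y

    open Rectangle

    swap : Rectangle → Rectangle
    swap r .left   = r .right
    swap r .right  = r .left
    swap r .inside x∈ y∈ = W-sym (r .inside y∈ x∈)

    Allowed : Rectangle → Pred Carrier ℓ
    Allowed r x = All (λ y → W y x) (r .right)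

    allowed-open : ∀ r → IsScottOpen (Allowed r)
    allowed-open r = go (r .right)
      where
      go : ∀ ys → IsScottOpen (λ x → All (λ y → W y x) ys)
      go []       = scott-≐ ((λ _ → []) , _) scott-U
      go (y ∷ ys) = scott-≐ ((λ (p , ps) → p ∷ ps) , (λ where (p ∷ ps) → p , ps))
                            (scott-∩ (W-open y) (go ys))

    insert : ∀ r x → x ∈ Allowed r → Rectangle
    insert r x ok .left  = x ∷ r .left
    insert r x ok .right = r .right
    insert r x ok .inside (here refl) y∈ = W-sym (All.lookup ok y∈)
    insert r x ok .inside (there x∈)  y∈ = r .inside x∈ y∈

    extend : Pred Carrier q → Rectangle → Rectangle
    extend Q r with em {P = Allowed r ≬ Q}
    ... | yes (x , ok , _) = insert r x ok
    ... | no  _            = r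

    extend-left : ∀ (Q : Pred Carrier q) r {x} →
                  x ∈ˡ r .left → x ∈ˡ extend Q r .left
    extend-left Q r x∈ with em {P = Allowed r ≬ Q}
    ... | yes _ = there x∈
    ... | no  _ = x∈

    extend-right : ∀ (Q : Pred Carrier q) r {x} →
                   x ∈ˡ r .right → x ∈ˡ extend Q r .right
    extend-right Q r x∈ with em {P = Allowed r ≬ Q}
    ... | yes _ = x∈
    ... | no  _ = x∈

    extend-meets : ∀ (Q : Pred Carrier q) r → Allowed r ≬ Q →
                   ∃[ x ] (x ∈ˡ extend Q r .left × x ∈ Q)
    extend-meets Q r hit with em {P = Allowed r ≬ Q}
    ... | yes (x , _ , x∈Q) = x , here refl , x∈Q
    ... | no  none          = ⊥-elim (none hit)

    module Stages
      (Q : ℕ → Pred Carrier q) {a b : Carrier} (Wab : W a b)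
      where

      -- `Q n` is offered first to the left side, then to the right. `extend` acts on left sides
      -- only, so `halfway n` has the sides exchanged and `stage (suc n)` restores them.
      stage halfway : ℕ → Rectangle
      stage zero .left  = a ∷ []
      stage zero .right = b ∷ []
      stage zero .inside (here refl) (here refl) = Wab
      stage (suc n) = swap (extend (Q n) (halfway n))

      halfway n = swap (extend (Q n) (stage n))

      Left Right : Pred Carrier ℓ
      Left  x = ∃[ n ] Any (_≤ x) (stage n .left)
      Right x = ∃[ n ] Any (_≤ x) (stage n .right)

      left-step : ∀ n {x} → x ∈ˡ stage n .left → x ∈ˡ stage (suc n) .left
      left-step n = extend-right (Q n) (halfway n) ∘ extend-left (Q n) (stage n)

      right-step : ∀ n {x} → x ∈ˡ stage n .right → x ∈ˡ stage (suc n) .right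
      right-step n = extend-left (Q n) (halfway n) ∘ extend-right (Q n) (stage n)

      left-mono : ∀ {m n x} → m ≤′ n → x ∈ˡ stage m .left → x ∈ˡ stage n .left
      left-mono ≤′-refl         = id
      left-mono (≤′-step m≤′n) = left-step _ ∘ left-mono m≤′n

      right-mono : ∀ {m n x} → m ≤′ n → x ∈ˡ stage m .right → x ∈ˡ stage n .right
      right-mono ≤′-refl         = id
      right-mono (≤′-step m≤′n) = right-step _ ∘ right-mono m≤′n

      W-up : ∀ {x x′ y y′} → x ≤ x′ → y ≤ y′ → W x y → W x′ y′
      W-up x≤x′ y≤y′ = W-sym ∘ W-open _ .up x≤x′ ∘ W-sym ∘ W-open _ .up y≤y′

      inside-W : ∀ {x y} → x ∈ Left → y ∈ Right → W x y
      inside-W (m , p) (n , p′) =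
        let x₀ , x₀∈ , x₀≤x = find p
            y₀ , y₀∈ , y₀≤y = find p′
        in  W-up x₀≤x y₀≤y (stage (m ⊔ n) .inside
              (left-mono (≤⇒≤′ (m≤m⊔n m n)) x₀∈)
              (right-mono (≤⇒≤′ (m≤n⊔m m n)) y₀∈))

      member : ∀ {x} {xs : List Carrier} → x ∈ˡ xs → Any (_≤ x) xs
      member = Any.map λ where refl → ≤-refl

      -- `m` may enter `Left` after stage `n`, but `W` relates it to all of `Right`, so
      -- `Allowed (stage n)` is a neighbourhood of `m`. Density then supplies a member of `Q n` for
      -- `extend` to add.
      Left-meets : ∀ n → Meets Left (Q n)
      Left-meets n m∈ dense =
        let x , x∈ , x∈Q = extend-meets (Q n) (stage n)
              (dense _ (allowed-open (stage n))
                (All.tabulate λ y∈ → W-sym (inside-W m∈ (n , member y∈))))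
        in  x , (suc n , member (extend-right (Q n) (halfway n) x∈)) , x∈Q

      Right-meets : ∀ n → Meets Right (Q n)
      Right-meets n m∈ dense =
        let x , x∈ , x∈Q = extend-meets (Q n) (halfway n)
              (dense _ (allowed-open (halfway n))
                -- The right side of `halfway n` is the left side after its extension, hence part of
                -- `stage (suc n)`.
                (All.tabulate λ y∈ → inside-W
                  (suc n , member (extend-right (Q n) (halfway n) y∈)) m∈))
        in  x , (suc n , member x∈) , x∈Q

      Left-up : UpClosed Left
      Left-up x≤y = map₂ (Any.map (flip ≤-trans x≤y))

      Right-up : UpClosed Right
      Right-up x≤y = map₂ (Any.map (flip ≤-trans x≤y))

  -- Countability and meet-continuity.

  module Countable
    (p₀ : Carrier)
    (countable : IsCountable (Poset.Eq.setoid P))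
    (dcpo : IsDCPO)
    (meetContinuous : IsMeetContinuous)
    (sups : IdealsHaveNonemptySups)
    where

    open Injection countable using (to; injective)

    -- By `off-diagonal`, a supremum of terms of `w` that omits `w l` lies below `d l`, so it cannot
    -- lie above `w l`. The supremum thus remembers which terms went in, and `S` is chosen to
    -- disagree with it at its own code.
    no-independent-sequence :
      ∀ {r} (w d : ℕ → Carrier) → (∀ n → w n ≤ r) → (∀ n → d n ≤ r) →
      (∀ {n l} → n ≢ l → w n ≤ d l) → ¬ (∀ n → ¬ w n ≤ d n)
    no-independent-sequence {r} w d w≤r d≤r off-diagonal diagonal =
      code∉S (v , refl , w≰v)
      where
      -- Cantor's diagonal set; T uses 0 and the shift of S, so as to be nonempty.
      S : Pred ℕ ℓ
      S n = ∃[ p ] (n ≡ to p × ¬ w (suc n) ≤ p)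

      T : Pred Carrier ℓ
      T x = x ≡ w 0 ⊎ ∃[ n ] (n ∈ S × x ≡ w (suc n))

      v-lub : ∃ (IsLubIn (↓ r) T)
      v-lub = sups r T (w 0 , inj₁ refl) λ where
        (inj₁ refl)           → w≤r 0
        (inj₂ (n , _ , refl)) → w≤r (suc n)

      v = proj₁ v-lub
      open IsLubIn (proj₂ v-lub) renaming (upper to v-upper; least to v-least)

      code∉S : ¬ to v ∈ S
      code∉S code∈S@(p , eq , w≰p) =
        w≰p (≤-trans (v-upper (inj₂ (to v , code∈S , refl)))
                     (reflexive (injective eq)))

      w≰v : ¬ w (suc (to v)) ≤ v
      w≰v w≤v = diagonal (suc (to v)) (≤-trans w≤v (v-least (d≤r _) λ where
        (inj₁ refl)             → off-diagonal λ ()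
        (inj₂ (n , n∈S , refl)) → off-diagonal λ where refl → code∉S n∈S))

    -- Meet-continuity puts `m` in the closure of the trace `↓ m ∩ ↓ˢᵉᵗ D`. Therefore the trace is
    -- nonempty, and `m` is below its supremum, whose principal ideal is closed.
    trace : ∀ (D : Pred Carrier ℓ) {t m} → IsDirected _≤_ D → IsLub D t → m ≤ t →
            IsDirected _≤_ (↓ m ∩ ↓ˢᵉᵗ D) × IsLub (↓ m ∩ ↓ˢᵉᵗ D) m
    trace D {t} {m} dir lub m≤t = dir′ , record
      { upper = proj₁
      ; least = λ ub → ≤-trans
          (in-closure _ (∁↓-open _) (proj₂ (dcpo _ dir′) .upper))
          (proj₂ (dcpo _ dir′) .least ub)
      }
      where
      in-closure = meetContinuous m D t dir lub m≤t

      bound : ∀ {x y} → x ∈ ↓ m ∩ ↓ˢᵉᵗ D → y ∈ ↓ m ∩ ↓ˢᵉᵗ D →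
              ∃[ z ] (z ∈ ↓ m ∩ ↓ˢᵉᵗ D × x ≤ z × y ≤ z)
      bound {x} {y} (x≤m , d , d∈D , x≤d) (y≤m , e , e∈D , y≤e) =
        let f , f∈D , d≤f , e≤f = proj₂ dir d∈D e∈D
            -- `m` and `f` are upper bounds of `x` and `y` in `↓ t`, so a join taken there lies
            -- below both.
            z , z-lub           = sups t (λ u → u ≡ x ⊎ u ≡ y) (x , inj₁ refl) λ where
                                    (inj₁ refl) → ≤-trans x≤m m≤t
                                    (inj₂ refl) → ≤-trans y≤m m≤t
            open IsLubIn z-lub renaming (upper to z-upper; least to z-least)
        in  z , ( z-least m≤t (λ where
                    (inj₁ refl) → x≤m
                    (inj₂ refl) → y≤m)
                , f , f∈D , z-least (lub .upper f∈D) (λ where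
                    (inj₁ refl) → ≤-trans x≤d d≤f
                    (inj₂ refl) → ≤-trans y≤e e≤f))
              , z-upper (inj₁ refl) , z-upper (inj₂ refl)

      dir′ : IsDirected _≤_ (↓ m ∩ ↓ˢᵉᵗ D)
      dir′ = stable (λ empty → Level.lower
               (in-closure _ ∅-closed λ {x} x∈ → lift (empty (x , x∈)))) , bound

    -- In the ideal ↓ s, every ideal that contains u and has a supremum above m
    -- must contain the forced elements.
    Forced : (s u m : Carrier) → Pred Carrier (lsuc ℓ)
    Forced s u m y =
      Σ (Pred Carrier ℓ) λ O → IsScottOpen O × m ∈ O ×
      (∀ {x d} → x ∈ O → x ≤ m → d ≤ s → u ≤ d → x ≤ d → y ≤ d)

    -- `d` will be the partner of `w` in the independent sequence, and `y` the next `m`.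
    Separated : (s u m w : Carrier) → Pred Carrier ℓ
    Separated s u m w y = y ≤ m × ∃[ d ] (d ≤ s × u ≤ d × y ≤ d × ¬ w ≤ d)

    -- A task is given by four points and mentions no directed set, so a countable poset has only
    -- countably many. These are the sets `Q n` of the construction.
    Task : (s u m w : Carrier) → Pred Carrier (lsuc ℓ)
    Task s u m w y = Separated s u m w y ⊎ Forced s u m y

    -- A directed set that escapes a set meeting every task.

    module Escape
      {V : Pred Carrier ℓ} (V-up : UpClosed V)
      (V-meets : ∀ s u m w → Meets V (Task s u m w))
      {D t} (dir : IsDirected _≤_ D) (lub : IsLub D t) (t∈V : t ∈ V)
      (escapes : ¬ (D ≬ V))
      where

      -- In the sequence built below, `u` lies above all earlier `w`, while `m` lies below all
      -- earlier `d` and bounds every `w` still to be chosen. Keeping `u` in `D` and `m` in `V` lets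
      -- the construction continue.
      record State : Set ℓ where
        field
          u m : Carrier
          u∈D : u ∈ D
          m∈V : m ∈ V
          m≤t : m ≤ t

      open State

      record Step (σ : State) : Set ℓ where
        field
          w d   : Carrier
          w≤m   : w ≤ σ .m
          d≤t   : d ≤ t
          u≤d   : σ .u ≤ d
          w≰d   : ¬ w ≤ d
          next  : State
          u≤    : σ .u ≤ next .u
          w≤u   : w ≤ next .u
          m≤    : next .m ≤ σ .m
          m≤d   : next .m ≤ d

      open Step

      -- The trace of `D` below `m` meets `O`, so some member of `D` above `u` also lies above `y`;
      -- with `y` in `V` it would be in `V`.
      forced∉V : ∀ σ {y} → y ∈ Forced t (σ .u) (σ .m) → ¬ y ∈ V
      forced∉V σ (O , O-open , m∈O , force) y∈V =
        let dir′ , lub′ = trace D dir lub (σ .m≤t)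
            x , (x≤m , e , e∈D , x≤e) , x∈O = O-open .inaccessible dir′ lub′ m∈O
            d , d∈D , e≤d , u≤d = proj₂ dir e∈D (σ .u∈D)
        in  escapes (d , d∈D , V-up
              (force x∈O x≤m (lub .upper d∈D) u≤d (≤-trans x≤e e≤d)) y∈V)

      -- If everything in the trace of D below m is forced, then every open O ∋ m
      -- contains a forced element, so any w in the trace will do.
      candidate : ∀ σ → ∃[ w ] (w ∈ ↓ (σ .m) ∩ ↓ˢᵉᵗ D ×
        (∀ O → IsScottOpen O → σ .m ∈ O → O ≬ Task t (σ .u) (σ .m) w))
      candidate σ with trace D dir lub (σ .m≤t)
      ... | dir′ , lub′
        with em {P = ∃[ w ] (w ∈ ↓ (σ .m) ∩ ↓ˢᵉᵗ D × ¬ w ∈ Forced t (σ .u) (σ .m))}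
      -- No open set around `m` makes `w` forced; the failure of forcing inside `O` is a `Separated`
      -- point.
      ... | yes (w , w∈ , unforced) = w , w∈ , λ O O-open m∈O → stable λ none →
              unforced (O , O-open , m∈O , λ {x} {d} x∈O x≤m d≤t u≤d x≤d →
                stable λ w≰d → none
                  (x , x∈O , inj₁ (x≤m , d , d≤t , u≤d , x≤d , w≰d)))
      ... | no all-forced = proj₁ (proj₁ dir′) , proj₂ (proj₁ dir′) ,
              λ O O-open m∈O →
                let x , x∈ , x∈O = O-open .inaccessible dir′ lub′ m∈O
                in  x , x∈O , inj₂ (stable λ unforced → all-forced (x , x∈ , unforced))

      step : ∀ σ → Step σ
      step σ with candidate σ
      ... | w , (w≤m , e , e∈D , w≤e) , dense
        with V-meets t (σ .u) (σ .m) w (σ .m∈V) dense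
      ... | y , y∈V , inj₂ forced = ⊥-elim (forced∉V σ forced y∈V)
      ... | y , y∈V , inj₁ (y≤m , d , d≤t , u≤d , y≤d , w≰d) =
        -- The next `u` is above `e`, hence above `w`, so that all later `d` are above `w`.
        let u′ , u′∈D , e≤u′ , u≤u′ = proj₂ dir e∈D (σ .u∈D)
        in  record
              { w = w ; d = d ; w≤m = w≤m ; d≤t = d≤t ; u≤d = u≤d ; w≰d = w≰d
              ; next = record
                  { u = u′ ; m = y ; u∈D = u′∈D ; m∈V = y∈V
                  ; m≤t = ≤-trans y≤m (σ .m≤t) }
              ; u≤ = u≤u′ ; w≤u = ≤-trans w≤e e≤u′ ; m≤ = y≤m ; m≤d = y≤d
              }

      state : ℕ → State
      state zero = record
        { u = proj₁ (proj₁ dir) ; m = t ; u∈D = proj₂ (proj₁ dir)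
        ; m∈V = t∈V ; m≤t = ≤-refl }
      state (suc n) = step (state n) .next

      u-mono : ∀ {k n} → k ≤′ n → state k .u ≤ state n .u
      u-mono ≤′-refl           = ≤-refl
      u-mono (≤′-step {n} k≤n) = ≤-trans (u-mono k≤n) (step (state n) .u≤)

      m-anti : ∀ {k n} → k ≤′ n → state n .m ≤ state k .m
      m-anti ≤′-refl           = ≤-refl
      m-anti (≤′-step {n} k≤n) = ≤-trans (step (state n) .m≤) (m-anti k≤n)

      off-diagonal : ∀ {n l} → n ≢ l → step (state n) .w ≤ step (state l) .d
      off-diagonal {n} {l} n≢l with <-cmp n l
      -- The strict inequalities read `suc n ≤ l` and `suc l ≤ n`, matching the bounds that a step
      -- puts on its next state.
      ... | tri< n<l _ _ = ≤-trans (step (state n) .w≤u)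
              (≤-trans (u-mono (≤⇒≤′ n<l)) (step (state l) .u≤d))
      ... | tri≈ _ n≡l _ = ⊥-elim (n≢l n≡l)
      ... | tri> _ _ l<n = ≤-trans (step (state n) .w≤m)
              (≤-trans (m-anti (≤⇒≤′ l<n)) (step (state l) .m≤d))

      contradiction : ⊥
      contradiction = no-independent-sequence
        (λ n → step (state n) .w) (λ n → step (state n) .d)
        (λ n → ≤-trans (step (state n) .w≤m) (state n .m≤t))
        (λ n → step (state n) .d≤t)
        off-diagonal (λ n → step (state n) .w≰d)

    meets-tasks⇒open : ∀ {V} → UpClosed V → (∀ s u m w → Meets V (Task s u m w)) →
                       IsScottOpen V
    meets-tasks⇒open V-up V-meets .up = V-up
    meets-tasks⇒open V-up V-meets .inaccessible dir lub t∈V =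
      stable (Escape.contradiction V-up V-meets dir lub t∈V)

    -- Enumeration of the tasks.

    Task-resp : ∀ {s s′ u u′ m m′ w w′} → s ≈ s′ → u ≈ u′ → m ≈ m′ → w ≈ w′ →
                Task s u m w ⊆ Task s′ u′ m′ w′
    Task-resp s≈ u≈ m≈ w≈ (inj₁ (y≤m , d , d≤s , u≤d , y≤d , w≰d)) =
      inj₁ ( ≤-trans y≤m (reflexive m≈) , d
           , ≤-trans d≤s (reflexive s≈)
           , ≤-trans (reflexive (Eq.sym u≈)) u≤d
           , y≤d
           , w≰d ∘ ≤-trans (reflexive w≈))
    Task-resp s≈ u≈ m≈ w≈ (inj₂ (O , O-open , m∈O , force)) =
      inj₂ ( O , O-open , O-open .up (reflexive m≈) m∈O
           , λ x∈O x≤m d≤s u≤d → force x∈O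
               (≤-trans x≤m (reflexive (Eq.sym m≈)))
               (≤-trans d≤s (reflexive (Eq.sym s≈)))
               (≤-trans (reflexive u≈) u≤d))

    decode : ℕ → Carrier
    decode n with em {P = ∃[ p ] to p ≡ n}
    ... | yes (p , _) = p
    -- A number that codes no point only repeats tasks of `p₀`.
    ... | no  _       = p₀

    -- Codes are injective only up to `≈`, which is why tasks must respect `≈`.
    decode-to : ∀ p → decode (to p) ≈ p
    decode-to p with em {P = ∃[ p′ ] to p′ ≡ to p}
    ... | yes (_ , eq) = injective eq
    ... | no  none     = ⊥-elim (none (p , refl))

    task : ℕ → Pred Carrier (lsuc ℓ)
    task n =
      let i , j = unpair n
          s , u = unpair i
          m , w = unpair j
      in  Task (decode s) (decode u) (decode m) (decode w)

    task-surjective : ∀ s u m w → ∃[ n ] task n ≐ Task s u m w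
    task-surjective s u m w
      with i , eqᵢ ← unpair-surjective (to s) (to u)
      with j , eqⱼ ← unpair-surjective (to m) (to w)
      with n , eqₙ ← unpair-surjective i j
      = n , subst (_≐ Task s u m w) (sym task≡)
              ( Task-resp (decode-to s) (decode-to u) (decode-to m) (decode-to w)
              , Task-resp (Eq.sym (decode-to s)) (Eq.sym (decode-to u))
                          (Eq.sym (decode-to m)) (Eq.sym (decode-to w)))
      where
      task≡ : task n ≡ Task (decode (to s)) (decode (to u)) (decode (to m)) (decode (to w))
      task≡ rewrite eqₙ | eqᵢ | eqⱼ = refl

    meets-task⇒open : ∀ {V} → UpClosed V → (∀ n → Meets V (task n)) → IsScottOpen V
    meets-task⇒open V-up V-meets = meets-tasks⇒open V-up λ s u m w m∈V dense →
      let n , task⊆ , ⊆task = task-surjective s u m w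
          y , y∈V , y∈task  = V-meets n m∈V λ O O-open m∈O →
                                map₂ (map₂ ⊆task) (dense O O-open m∈O)
      in  y , y∈V , task⊆ y∈task

    -- From open rectangles to sobriety.

    open-rectangle : (W : Rel Carrier ℓ) → (∀ {x y} → W x y → W y x) →
      (∀ x → IsScottOpen (W x)) → ∀ {a b} → W a b →
      ∃₂ λ V V′ → IsScottOpen V × IsScottOpen V′ × a ∈ V × b ∈ V′ ×
                  (∀ {x y} → x ∈ V → y ∈ V′ → W x y)
    open-rectangle W W-sym W-open Wab =
      Left , Right , meets-task⇒open Left-up Left-meets ,
      meets-task⇒open Right-up Right-meets ,
      (0 , here ≤-refl) , (0 , here ≤-refl) , inside-W
      where
      open Rectangles W W-sym W-open
      open Stages task Wab

    -- If `a` and `b` had no bound in `A`, irreducibility would give a `c ∈ A` in both sides of an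
    -- open rectangle of incompatible pairs; but `c` is compatible with itself.
    irreducible⇒directed : IsStrongDSpace → ∀ {A} → IsScottClosed A →
                           IsIrreducibleσ A → IsDirected _≤_ A
    irreducible⇒directed sd {A} closed (ne , irr) =
      ne , λ {a} {b} a∈A b∈A → stable λ a#b →
        let V , V′ , V-open , V′-open , a∈V , b∈V′ , V×V′⊆ =
              open-rectangle (Incompatible A)
                (λ x#y (c , c∈A , y≤c , x≤c) → x#y (c , c∈A , x≤c , y≤c))
                (incompatible-open sd closed) a#b
            c , c∈A , c∈V , c∈V′ =
              irr V V′ V-open V′-open (a , a∈A , a∈V) (b , b∈A , b∈V′)
        in  V×V′⊆ c∈V c∈V′ (c , c∈A , ≤-refl , ≤-refl)

    strongD⇒sober : IsStrongDSpace → IsScottSober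
    strongD⇒sober sd A closed irr =
      let dir     = irreducible⇒directed sd closed irr
          s , lub = dcpo A dir
          s∈A     = stable λ s∉A → let d , d∈A , d∉A = closed .inaccessible dir lub s∉A
                                   in  d∉A d∈A
      in  s , (lub .upper , λ x≤s → stable λ x∉A → closed .up x≤s x∉A s∈A) ,
          λ (A⊆ , ⊆A) → antisym (A⊆ s∈A) (lub .upper (⊆A ≤-refl))

corollary5p5 : (∀ {a} → ExcludedMiddle a) →
    ∀ {ℓ} (P : Poset ℓ ℓ ℓ) →
    let open PosetTheory P in
    Poset.Carrier P →
    IsCountable (Poset.Eq.setoid P) →
    IsDCPO →
    IsMeetContinuous →
    IdealsHaveNonemptySups →
    IsStrongDSpace ⊎ HasPropertyR ⊎ (IsWellFiltered × IsCoherent) ⊎ IsUpperSemicompact →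
    IsScottSober
corollary5p5 em P p₀ countable dcpo meetContinuous sups =
  strongD⇒sober ∘
  [ id , [ propertyR⇒strongD , [ wellFiltered×coherent⇒strongD , upperSemicompact⇒strongD ]′ ]′ ]′
  where
  open Classical em P
  open Countable p₀ countable dcpo meetContinuous sups
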